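{- Let $S$ be a nonempty finite multiset of positive integers, let $n=|S|$ (counting multiplicities), and let $m=\max(S)$. Suppose that no element of $S$ has multiplicity greater than one, and that for all $a,b,c\in S$ with $a<b<c$ we have $(m-a)\geq (m-b)+(m-c)+n-3$. Then for every finite poset $(P,\leq)$ whose multiset of cardinalities of maximal chains equals $S$, we have $|P|\geq m+n-1$.
   Context: A chain in a poset is a subset any two elements of which are comparable; a chain is maximal if it is not properly contained in any other chain. The multiset of cardinalities of maximal chains of $P$ contains one entry $|C|$ for each maximal chain $C$ of $P$. -}

module Defs where

open import Level using (0ℓ)
open import Data.Nat using (ℕ; _+_; _∸_; _≤_; _<_; _⊔_)
open import Data.Fin using (Fin)
open import Data.Fin.Subset using (Subset; _∈_; _⊆_; ∣_∣)
open import Data.List using (List; map; length; foldr)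
open import Data.List.Relation.Unary.Unique.Propositional using (Unique)
open import Data.List.Relation.Binary.Permutation.Propositional using (_↭_)
import Data.List.Membership.Propositional as LM
open import Data.Product using (Σ; _×_)
open import Relation.Binary.Core using (Rel)
open import Data.Sum using (_⊎_)
open import Function.Bundles using (_⇔_)

-- A finite poset with k elements: carrier Fin k, order _≼_ (any partial order
-- w.r.t. propositional equality).

IsChain : ∀ {k} (_≼_ : Rel (Fin k) 0ℓ) → Subset k → Set
IsChain _≼_ C = ∀ x y → x ∈ C → y ∈ C → (x ≼ y) ⊎ (y ≼ x)

IsMaximalChain : ∀ {k} (_≼_ : Rel (Fin k) 0ℓ) → Subset k → Set
IsMaximalChain _≼_ C = IsChain _≼_ C × (∀ D → IsChain _≼_ D → C ⊆ D → D ⊆ C)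

MaxChainCardsEq : ∀ {k} (_≼_ : Rel (Fin k) 0ℓ) → List ℕ → Set
MaxChainCardsEq {k} _≼_ S =
  Σ (List (Subset k)) λ L →
    Unique L × (∀ C → (C LM.∈ L) ⇔ IsMaximalChain _≼_ C) × (map ∣_∣ L ↭ S)

-- maximum of a list of naturals (equals max S for nonempty S)
maxList : List ℕ → ℕ
maxList = foldr _⊔_ 0

{-# OPTIONS --safe #-}
-- Let C be a maximal chain of size m.
--
-- If two maximal chains D, E meet in x, then exchanging their parts above x
-- gives two maximal chains F, G with |F| + |G| = |D| + |E|.  Four distinct
-- sizes p < r < s < q with p + q = r + s would violate the hypothesis, so D
-- and E agree below x or agree above x.
--
-- If every maximal chain has an element lying in no larger maximal chain,
-- these elements are distinct, and those of the n - 1 chains other than C lie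
-- outside C; hence |P| ≥ m + (n - 1).
--
-- Otherwise some D is covered by larger maximal chains.  Each of these agrees
-- with D below or above a common point, so D is covered by just two of them:
-- J, which agrees with D below some u, and K, which agrees with D above some
-- v > u.  Then J ∩ K ⊆ D ∖ {u , v}, and the hypothesis for D, J, K gives
-- |P| ≥ |J ∪ K| ≥ |J| + |K| - |D| + 2 ≥ m + n - 1.
module Submission where

open import Defs
open import Level using (0ℓ)
open import Data.Nat using (ℕ; suc; _+_; _∸_; _≤_; _<_; z≤n; s≤s; _<?_)
open import Data.Nat.Properties using (module ≤-Reasoning; +-cancelˡ-≤; +-cancelʳ-≤; +-comm; +-suc; +-mono-≤; +-monoˡ-≤; +-monoʳ-≤; <-cmp; <⇒≢; <⇒≱; m+[n∸m]≡n; m≤m⊔n; m≤n⊔m; m≤n+m∸n; m≤n+o⇒m∸n≤o; n≮0; ≤-<-trans; ≤-refl; ≤-trans; ≤∧≢⇒<; ⊔-sel; _≤?_)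
open import Data.Nat.Tactic.RingSolver using (solve-∀)
open import Data.Bool.Properties using () renaming (_≟_ to _≟ᵇ_)
open import Data.Empty using (⊥-elim)
open import Data.Fin using (Fin) renaming (_≟_ to _≟ᶠ_)
open import Data.Fin.Induction using (po-wellFounded; Acc; acc)
open import Data.Fin.Properties using (any?; all?; sequence)
open import Data.Fin.Subset using (Subset; inside; outside; _∪_; _∩_; _-_; ⁅_⁆; ∣_∣; Nonempty; _⊆_) renaming (_∈_ to _∈ˢ_; _∉_ to _∉ˢ_)
open import Data.Fin.Subset.Properties using (_∈?_; Empty-unique; nonempty?; p⊂q⇒∣p∣<∣q∣; p⊆p∪q; p⊆q⇒∣p∣≤∣q∣; x∈p∧x≢y⇒x∈p-y; x∈p∩q⁺; x∈p∩q⁻; x∈p∪q⁺; x∈p∪q⁻; x∈p⇒∣p-x∣<∣p∣; x∈⁅x⁆; x∈⁅y⁆⇒x≡y; ∣p∣≤n; ∣⊥∣≡0; ⊆-antisym)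
open import Data.List using (List; []; _∷_; _++_; length; map)
open import Data.List.Membership.Propositional using (_∈_; find; lose)
open import Data.List.Membership.Propositional.Properties using (foldr-selective; ∈-map⁺; ∈-map⁻; ∈-∃++)
open import Data.List.Properties using (length-map)
open import Data.List.Relation.Binary.Permutation.Propositional using (_↭_; ↭-sym; ↭⇒↭ₛ)
open import Data.List.Relation.Binary.Permutation.Propositional.Properties using (shift; ↭-length; ∈-resp-↭)
open import Data.List.Relation.Binary.Permutation.Setoid.Properties using (Unique-resp-↭)
open import Data.List.Relation.Unary.All as All using (All; []; _∷_)
open import Data.List.Relation.Unary.All.Properties using (¬All⇒Any¬)
open import Data.List.Relation.Unary.AllPairs using ([]; _∷_)
open import Data.List.Relation.Unary.Any as Any using (Any; here; there)
open import Data.List.Relation.Unary.Unique.Propositional using (Unique)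
open import Data.Product using (∃; _×_; _,_; proj₁; proj₂; swap)
open import Data.Sum as Sum using (_⊎_; inj₁; inj₂; [_,_]′)
open import Data.Vec using ([]; _∷_; tabulate)
open import Data.Vec.Properties using (lookup∘tabulate; lookup⇒[]=; []=⇒lookup; ≡-dec)
open import Effect.Monad using (RawMonad)
open import Function using (_∘_; flip)
open import Function.Bundles using (Equivalence)
open import Relation.Binary.Core using (Rel)
open import Relation.Binary.Definitions using (DecidableEquality; tri<; tri≈; tri>) renaming (Decidable to Decidable₂)
open import Relation.Binary.Structures using (IsPartialOrder)
import Relation.Binary.Construct.Flip.EqAndOrd as Flip
open import Relation.Binary.PropositionalEquality using (_≡_; _≢_; refl; sym; trans; cong; cong₂; subst; setoid)
open import Relation.Nullary using (¬_; yes; no; does; contradiction)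
open import Relation.Nullary.Decidable using (¬?; _×-dec_; _⊎-dec_; _→-dec_; dec-true; decidable-stable; ¬¬-excluded-middle)
open import Relation.Nullary.Negation using (¬¬-Monad)
open import Relation.Unary using (Pred; Decidable)

private
  variable
    k : ℕ

-- Cardinalities of finite subsets, and systems of distinct representatives.

∣p∪q∣+∣p∩q∣≡∣p∣+∣q∣ : (p q : Subset k) → ∣ p ∪ q ∣ + ∣ p ∩ q ∣ ≡ ∣ p ∣ + ∣ q ∣
∣p∪q∣+∣p∩q∣≡∣p∣+∣q∣ []            []            = refl
∣p∪q∣+∣p∩q∣≡∣p∣+∣q∣ (outside ∷ p) (outside ∷ q) = ∣p∪q∣+∣p∩q∣≡∣p∣+∣q∣ p q
∣p∪q∣+∣p∩q∣≡∣p∣+∣q∣ (inside  ∷ p) (outside ∷ q) = cong suc (∣p∪q∣+∣p∩q∣≡∣p∣+∣q∣ p q)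
∣p∪q∣+∣p∩q∣≡∣p∣+∣q∣ (outside ∷ p) (inside  ∷ q) =
  trans (cong suc (∣p∪q∣+∣p∩q∣≡∣p∣+∣q∣ p q)) (sym (+-suc ∣ p ∣ ∣ q ∣))
∣p∪q∣+∣p∩q∣≡∣p∣+∣q∣ (inside  ∷ p) (inside  ∷ q) = cong suc
  (trans (+-suc ∣ p ∪ q ∣ ∣ p ∩ q ∣)
    (trans (cong suc (∣p∪q∣+∣p∩q∣≡∣p∣+∣q∣ p q)) (sym (+-suc ∣ p ∣ ∣ q ∣))))

_≟ˢ_ : DecidableEquality (Subset k)
_≟ˢ_ = ≡-dec _≟ᵇ_

0<∣p∣⇒Nonempty : (p : Subset k) → 0 < ∣ p ∣ → Nonempty p
0<∣p∣⇒Nonempty {k} p 0<∣p∣ with nonempty? p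
... | yes ne = ne
... | no ¬ne = contradiction 0<∣p∣
  (subst (λ s → ¬ 0 < s) (sym (trans (cong ∣_∣ (Empty-unique ¬ne)) (∣⊥∣≡0 k))) n≮0)

x∉p⇒∣p∣<∣p∪⁅x⁆∣ : ∀ {x} (p : Subset k) → x ∉ˢ p → ∣ p ∣ < ∣ p ∪ ⁅ x ⁆ ∣
x∉p⇒∣p∣<∣p∪⁅x⁆∣ {x = x} p x∉p =
  p⊂q⇒∣p∣<∣q∣ (p⊆p∪q ⁅ x ⁆ , x , x∈p∪q⁺ (inj₂ (x∈⁅x⁆ x)) , x∉p)

module _ {P : Pred (Fin k) 0ℓ} (P? : Decidable P) where

  comprehension : Subset k
  comprehension = tabulate (does ∘ P?)

  ∈-comprehension⁺ : ∀ {x} → P x → x ∈ˢ comprehension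
  ∈-comprehension⁺ {x} px =
    lookup⇒[]= x comprehension (trans (lookup∘tabulate (does ∘ P?) x) (dec-true (P? x) px))

  ∈-comprehension⁻ : ∀ {x} → x ∈ˢ comprehension → P x
  ∈-comprehension⁻ {x} x∈ with P? x | trans (sym (lookup∘tabulate (does ∘ P?) x)) ([]=⇒lookup x∈)
  ... | yes px | _ = px
  ... | no  _  | ()

-- Adds one representative outside `p` for each `a`. The last component tracks where each point of
-- `q` came from; it is the induction invariant showing, through injectivity of `R`, that the next
-- representative is not yet in `q`.
transversal : {A : Set} {R : A → Fin k → Set} →
  (∀ {a b x} → R a x → R b x → a ≡ b) →
  (p : Subset k) {as : List A} → Unique as → All (λ a → ∃ λ x → R a x × x ∉ˢ p) as →
  ∃ λ q → length as + ∣ p ∣ ≤ ∣ q ∣ × (∀ {x} → x ∈ˢ q → x ∈ˢ p ⊎ ∃ λ a → a ∈ as × R a x)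
transversal R-inj p [] [] = p , ≤-refl , inj₁
transversal {R = R} R-inj p {a ∷ as} (a∉as ∷ uniq) ((x , Rax , x∉p) ∷ Ras)
  with q , le , origin ← transversal R-inj p uniq Ras
  = q ∪ ⁅ x ⁆ , ≤-<-trans le (x∉p⇒∣p∣<∣p∪⁅x⁆∣ q x∉q) , origin′
  where
  x∉q : x ∉ˢ q
  x∉q x∈q with origin x∈q
  ... | inj₁ x∈p = x∉p x∈p
  ... | inj₂ (b , b∈as , Rbx) = All.lookup a∉as b∈as (R-inj Rax Rbx)

  origin′ : ∀ {y} → y ∈ˢ q ∪ ⁅ x ⁆ → y ∈ˢ p ⊎ ∃ λ b → b ∈ a ∷ as × R b y
  origin′ y∈ with x∈p∪q⁻ q ⁅ x ⁆ y∈
  ... | inj₁ y∈q = Sum.map₂ (λ (b , b∈as , Rby) → b , there b∈as , Rby) (origin y∈q)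
  ... | inj₂ y∈x rewrite x∈⁅y⁆⇒x≡y x y∈x = inj₂ (a , here refl , Rax)

-- Lists without repetition, and maxima of lists.

module _ {A : Set} where

  ∈⇒↭∷ : ∀ {x : A} {ys} → x ∈ ys → ∃ λ zs → ys ↭ x ∷ zs
  ∈⇒↭∷ {x} x∈ys with us , vs , refl ← ∈-∃++ x∈ys = us ++ vs , shift x us vs

  Unique⇒length≤ : ∀ {xs ys : List A} → Unique xs → All (_∈ ys) xs → length xs ≤ length ys
  Unique⇒length≤ [] [] = z≤n
  Unique⇒length≤ {x ∷ xs} {ys} (x∉xs ∷ uniq) (x∈ys ∷ xs⊆ys)
    with zs , ys↭ ← ∈⇒↭∷ x∈ys
    = subst (suc (length xs) ≤_) (sym (↭-length ys↭))
        (s≤s (Unique⇒length≤ uniq (All.zipWith in-rest (x∉xs , xs⊆ys))))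
    where
    in-rest : ∀ {y} → x ≢ y × y ∈ ys → y ∈ zs
    in-rest (x≢y , y∈ys) with ∈-resp-↭ ys↭ y∈ys
    ... | here y≡x   = contradiction (sym y≡x) x≢y
    ... | there y∈zs = y∈zs

  Unique-map⇒injective : ∀ {B : Set} {f : A → B} {xs} → Unique (map f xs) →
    ∀ {x y} → x ∈ xs → y ∈ xs → f x ≡ f y → x ≡ y
  Unique-map⇒injective (_ ∷ _) (here refl) (here refl) _ = refl
  Unique-map⇒injective {f = f} (fx∉ ∷ _) (here refl) (there y∈) eq =
    contradiction eq (All.lookup fx∉ (∈-map⁺ f y∈))
  Unique-map⇒injective {f = f} (fy∉ ∷ _) (there x∈) (here refl) eq =
    contradiction (sym eq) (All.lookup fy∉ (∈-map⁺ f x∈))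
  Unique-map⇒injective (_ ∷ uniq) (there x∈) (there y∈) eq =
    Unique-map⇒injective uniq x∈ y∈ eq

∈⇒≤maxList : ∀ {x xs} → x ∈ xs → x ≤ maxList xs
∈⇒≤maxList {xs = y ∷ ys} (here refl) = m≤m⊔n y (maxList ys)
∈⇒≤maxList {xs = y ∷ ys} (there x∈)  = ≤-trans (∈⇒≤maxList x∈) (m≤n⊔m y (maxList ys))

maxList∈ : ∀ {xs} → xs ≢ [] → All (1 ≤_) xs → maxList xs ∈ xs
maxList∈ {[]}     xs≢[] _ = contradiction refl xs≢[]
maxList∈ {x ∷ xs} _ (1≤x ∷ _) with foldr-selective ⊔-sel 0 (x ∷ xs)
... | inj₂ max∈  = max∈
-- Here `0` is the starting value of the fold; a positive head rules it out as the maximum.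
... | inj₁ max≡0 = contradiction (subst (1 ≤_) max≡0 (≤-trans 1≤x (m≤m⊔n x (maxList xs)))) n≮0

-- Extremal elements, and agreement of two subsets on a region.

-- Well-founded descent: as long as some element of `Q` lies strictly below `x`, move there; once
-- none does, totality on `Q` puts `x` below all of `Q`. Applied to the reversed order, this gives
-- greatest elements.
least : {_⊑_ : Rel (Fin k) 0ℓ} → IsPartialOrder _≡_ _⊑_ → Decidable₂ _⊑_ →
  {Q : Pred (Fin k) 0ℓ} → Decidable Q → (∀ {x y} → Q x → Q y → x ⊑ y ⊎ y ⊑ x) →
  ∃ Q → ∃ λ u → Q u × (∀ {y} → Q y → u ⊑ y)
least {k} {_⊑_} po _⊑?_ {Q} Q? total (x₀ , qx₀) = descend x₀ (po-wellFounded po x₀) qx₀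
  where
  open IsPartialOrder po using (reflexive)

  descend : ∀ x → Acc (λ a b → a ⊑ b × a ≢ b) x → Q x → ∃ λ u → Q u × (∀ {y} → Q y → u ⊑ y)
  descend x (acc rs) qx with any? (λ y → Q? y ×-dec ((y ⊑? x) ×-dec ¬? (y ≟ᶠ x)))
  ... | yes (y , qy , y⊏x) = descend y (rs y⊏x) qy
  ... | no ∄smaller = x , qx , λ {y} qy → [ (λ x⊑y → x⊑y) , below qy ]′ (total qx qy)
    where
    below : ∀ {y} → Q y → y ⊑ x → x ⊑ y
    below {y} qy y⊑x with y ≟ᶠ x
    ... | yes y≡x = reflexive (sym y≡x)
    ... | no  y≢x = contradiction (y , qy , y⊑x , y≢x) ∄smaller

Agree : Pred (Fin k) 0ℓ → Subset k → Subset k → Set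
Agree P D E = ∀ {y} → P y → (y ∈ˢ D → y ∈ˢ E) × (y ∈ˢ E → y ∈ˢ D)

module _ {P : Pred (Fin k) 0ℓ} where

  Agree-sym : ∀ {D E} → Agree P D E → Agree P E D
  Agree-sym agree Py = swap (agree Py)

  Agree-trans : ∀ {D E F} → Agree P D E → Agree P E F → Agree P D F
  Agree-trans DE EF Py = proj₁ (EF Py) ∘ proj₁ (DE Py) , proj₂ (DE Py) ∘ proj₂ (EF Py)

  Agree? : Decidable P → Decidable₂ (Agree P)
  Agree? P? D E with all? (λ y → P? y →-dec ((y ∈? D →-dec y ∈? E) ×-dec (y ∈? E →-dec y ∈? D)))
  ... | yes agree = yes (λ {y} → agree y)
  ... | no ¬agree = no (λ agree → ¬agree (λ y → agree {y}))

-- Exchanging the upper parts of two maximal chains.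

module Chains {_≼_ : Rel (Fin k) 0ℓ} (po : IsPartialOrder _≡_ _≼_) (_≼?_ : Decidable₂ _≼_) where

  open IsPartialOrder po renaming (refl to ≼-refl; trans to ≼-trans; antisym to ≼-antisym) using ()

  ⊆⇒≡ : ∀ {D E} → IsMaximalChain _≼_ D → IsMaximalChain _≼_ E → D ⊆ E → D ≡ E
  ⊆⇒≡ (_ , D-max) (E-chain , _) D⊆E = ⊆-antisym D⊆E (D-max _ E-chain D⊆E)

  maximal-absorbs : ∀ {D y} → IsMaximalChain _≼_ D →
    (∀ {z} → z ∈ˢ D → z ≼ y ⊎ y ≼ z) → y ∈ˢ D
  maximal-absorbs {D} {y} (D-chain , D-max) comparable =
    D-max (D ∪ ⁅ y ⁆) D+y-chain (p⊆p∪q ⁅ y ⁆) (x∈p∪q⁺ (inj₂ (x∈⁅x⁆ y)))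
    where
    D+y-chain : IsChain _≼_ (D ∪ ⁅ y ⁆)
    D+y-chain a b a∈ b∈ with x∈p∪q⁻ D ⁅ y ⁆ a∈ | x∈p∪q⁻ D ⁅ y ⁆ b∈
    ... | inj₁ a∈D | inj₁ b∈D = D-chain a b a∈D b∈D
    ... | inj₁ a∈D | inj₂ b∈y rewrite x∈⁅y⁆⇒x≡y y b∈y = comparable a∈D
    ... | inj₂ a∈y | inj₁ b∈D rewrite x∈⁅y⁆⇒x≡y y a∈y = Sum.swap (comparable b∈D)
    ... | inj₂ a∈y | inj₂ b∈y rewrite x∈⁅y⁆⇒x≡y y a∈y | x∈⁅y⁆⇒x≡y y b∈y = inj₁ ≼-refl

  InSplice : Fin k → Subset k → Subset k → Pred (Fin k) 0ℓ
  InSplice x D E y = (y ∈ˢ D × y ≼ x) ⊎ (y ∈ˢ E × x ≼ y)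

  InSplice? : ∀ x D E → Decidable (InSplice x D E)
  InSplice? x D E y = (y ∈? D ×-dec y ≼? x) ⊎-dec (y ∈? E ×-dec x ≼? y)

  splice : Fin k → Subset k → Subset k → Subset k
  splice x D E = comprehension (InSplice? x D E)

  module _ {x : Fin k} {D E : Subset k} where

    splice⁺ : ∀ {y} → InSplice x D E y → y ∈ˢ splice x D E
    splice⁺ = ∈-comprehension⁺ (InSplice? x D E)

    splice⁻ : ∀ {y} → y ∈ˢ splice x D E → InSplice x D E y
    splice⁻ = ∈-comprehension⁻ (InSplice? x D E)

    splice-chain : IsChain _≼_ D → IsChain _≼_ E → IsChain _≼_ (splice x D E)
    splice-chain D-chain E-chain a b a∈ b∈ with splice⁻ a∈ | splice⁻ b∈
    ... | inj₁ (a∈D , _)   | inj₁ (b∈D , _)   = D-chain a b a∈D b∈D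
    ... | inj₁ (_   , a≼x) | inj₂ (_   , x≼b) = inj₁ (≼-trans a≼x x≼b)
    ... | inj₂ (_   , x≼a) | inj₁ (_   , b≼x) = inj₂ (≼-trans b≼x x≼a)
    ... | inj₂ (a∈E , _)   | inj₂ (b∈E , _)   = E-chain a b a∈E b∈E

  module _ {x : Fin k} {D E : Subset k} (x∈D : x ∈ˢ D) (x∈E : x ∈ˢ E) where

    splice-below : Agree (_≼ x) (splice x D E) D
    splice-below {y} y≼x = to , λ y∈D → splice⁺ (inj₁ (y∈D , y≼x))
      where
      to : y ∈ˢ splice x D E → y ∈ˢ D
      to y∈ with splice⁻ y∈
      ... | inj₁ (y∈D , _) = y∈D
      ... | inj₂ (_ , x≼y) rewrite ≼-antisym y≼x x≼y = x∈D

    splice-above : Agree (x ≼_) (splice x D E) E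
    splice-above {y} x≼y = to , λ y∈E → splice⁺ (inj₂ (y∈E , x≼y))
      where
      to : y ∈ˢ splice x D E → y ∈ˢ E
      to y∈ with splice⁻ y∈
      ... | inj₂ (y∈E , _) = y∈E
      ... | inj₁ (_ , y≼x) rewrite ≼-antisym y≼x x≼y = x∈E

    -- Let a chain `F` extend the splice. It contains `x`, so each `y` in `F` is comparable with
    -- `x`. If `y ≼ x`, then `y` is comparable with the lower part of `D` inside `F`, and with the
    -- upper part through `x`; so `D` absorbs `y`. Above `x` the same works with `E`.
    splice-maximal : IsMaximalChain _≼_ D → IsMaximalChain _≼_ E →
      IsMaximalChain _≼_ (splice x D E)
    splice-maximal D-max@(D-chain , _) E-max@(E-chain , _) =
      splice-chain D-chain E-chain , maximal
      where
      maximal : ∀ F → IsChain _≼_ F → splice x D E ⊆ F → F ⊆ splice x D E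
      maximal F F-chain splice⊆F {y} y∈F
        with F-chain y x y∈F (splice⊆F (splice⁺ (inj₁ (x∈D , ≼-refl))))
      ... | inj₁ y≼x = splice⁺ (inj₁ (maximal-absorbs D-max comparable , y≼x))
        where
        comparable : ∀ {z} → z ∈ˢ D → z ≼ y ⊎ y ≼ z
        comparable {z} z∈D with D-chain z x z∈D x∈D
        ... | inj₁ z≼x = F-chain z y (splice⊆F (splice⁺ (inj₁ (z∈D , z≼x)))) y∈F
        ... | inj₂ x≼z = inj₂ (≼-trans y≼x x≼z)
      ... | inj₂ x≼y = splice⁺ (inj₂ (maximal-absorbs E-max comparable , x≼y))
        where
        comparable : ∀ {z} → z ∈ˢ E → z ≼ y ⊎ y ≼ z
        comparable {z} z∈E with E-chain z x z∈E x∈E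
        ... | inj₁ z≼x = inj₁ (≼-trans z≼x x≼y)
        ... | inj₂ x≼z = F-chain z y (splice⊆F (splice⁺ (inj₂ (z∈E , x≼z)))) y∈F

  module _ {x : Fin k} {D E : Subset k} (x∈D : x ∈ˢ D) (x∈E : x ∈ˢ E)
    (D-chain : IsChain _≼_ D) (E-chain : IsChain _≼_ E) where

    private
      F G : Subset k
      F = splice x D E
      G = splice x E D

    splice-∪ : F ∪ G ≡ D ∪ E
    splice-∪ = ⊆-antisym to from
      where
      to : F ∪ G ⊆ D ∪ E
      to y∈ with x∈p∪q⁻ F G y∈
      ... | inj₁ y∈F = x∈p∪q⁺ (Sum.map proj₁ proj₁ (splice⁻ y∈F))
      ... | inj₂ y∈G = x∈p∪q⁺ (Sum.swap (Sum.map proj₁ proj₁ (splice⁻ y∈G)))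

      from : D ∪ E ⊆ F ∪ G
      from {y} y∈ with x∈p∪q⁻ D E y∈
      ... | inj₁ y∈D = x∈p∪q⁺ (Sum.map (λ y≼x → splice⁺ (inj₁ (y∈D , y≼x)))
                                       (λ x≼y → splice⁺ (inj₂ (y∈D , x≼y))) (D-chain y x y∈D x∈D))
      ... | inj₂ y∈E = x∈p∪q⁺ (Sum.swap (Sum.map (λ y≼x → splice⁺ (inj₁ (y∈E , y≼x)))
                                                 (λ x≼y → splice⁺ (inj₂ (y∈E , x≼y))) (E-chain y x y∈E x∈E)))

    splice-∩ : F ∩ G ≡ D ∩ E
    splice-∩ = ⊆-antisym to from
      where
      to : F ∩ G ⊆ D ∩ E
      to {y} y∈ with y∈F , y∈G ← x∈p∩q⁻ F G y∈ with splice⁻ y∈F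
      ... | inj₁ (y∈D , y≼x) = x∈p∩q⁺ (y∈D , proj₁ (splice-below x∈E x∈D y≼x) y∈G)
      ... | inj₂ (y∈E , x≼y) = x∈p∩q⁺ (proj₁ (splice-above x∈E x∈D x≼y) y∈G , y∈E)

      from : D ∩ E ⊆ F ∩ G
      from {y} y∈ with y∈D , y∈E ← x∈p∩q⁻ D E y∈ with D-chain y x y∈D x∈D
      ... | inj₁ y≼x = x∈p∩q⁺ (splice⁺ (inj₁ (y∈D , y≼x)) , splice⁺ (inj₁ (y∈E , y≼x)))
      ... | inj₂ x≼y = x∈p∩q⁺ (splice⁺ (inj₂ (y∈E , x≼y)) , splice⁺ (inj₂ (y∈D , x≼y)))

    -- The exchange changes neither the union nor the intersection, so inclusion-exclusion gives
    -- both pairs the same total.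
    ∣splice∣+∣splice∣ : ∣ F ∣ + ∣ G ∣ ≡ ∣ D ∣ + ∣ E ∣
    ∣splice∣+∣splice∣ = trans (sym (∣p∪q∣+∣p∩q∣≡∣p∣+∣q∣ F G))
      (trans (cong₂ (λ p q → ∣ p ∣ + ∣ q ∣) splice-∪ splice-∩) (∣p∪q∣+∣p∩q∣≡∣p∣+∣q∣ D E))

-- Arithmetic of the condition on sizes.

SpreadOut : List ℕ → Set
SpreadOut S = ∀ {a b c} → a ∈ S → b ∈ S → c ∈ S → a < b → b < c →
  maxList S + a + length S ≤ b + c + 3

-- The differences from `maxList S` are exact, since entries are bounded by the maximum.
-- `length S ∸ 3` may truncate, but `length S ≤ 3 + (length S ∸ 3)` always holds and suffices.
∸-condition⇒SpreadOut : ∀ {S} →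
  (∀ a b c → a ∈ S → b ∈ S → c ∈ S → a < b → b < c →
    (maxList S ∸ b) + (maxList S ∸ c) + (length S ∸ 3) ≤ maxList S ∸ a) →
  SpreadOut S
∸-condition⇒SpreadOut {S} H {a} {b} {c} a∈ b∈ c∈ a<b b<c =
  lemma (maxList S ∸ a) (maxList S ∸ b) (maxList S ∸ c) (length S ∸ 3)
    (m+[n∸m]≡n (∈⇒≤maxList a∈)) (m+[n∸m]≡n (∈⇒≤maxList b∈)) (m+[n∸m]≡n (∈⇒≤maxList c∈))
    (m≤n+m∸n (length S) 3) (H a b c a∈ b∈ c∈ a<b b<c)
  where
  open ≤-Reasoning
  rearrange₁ : ∀ m a da t → (m + a + (3 + t)) + da ≡ m + (a + da) + 3 + t
  rearrange₁ = solve-∀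
  rearrange₂ : ∀ b db c dc t → (b + db) + (c + dc) + 3 + t ≡ b + c + 3 + (db + dc + t)
  rearrange₂ = solve-∀
  lemma : ∀ {m n} da db dc t → a + da ≡ m → b + db ≡ m → c + dc ≡ m → n ≤ 3 + t →
    db + dc + t ≤ da → m + a + n ≤ b + c + 3
  lemma {m} {n} da db dc t ea eb ec n≤ le = +-cancelʳ-≤ da _ _ (begin
    m + a + n + da               ≤⟨ +-monoˡ-≤ da (+-monoʳ-≤ (m + a) n≤) ⟩
    m + a + (3 + t) + da         ≡⟨ rearrange₁ m a da t ⟩
    m + (a + da) + 3 + t         ≡⟨ cong (λ s → m + s + 3 + t) ea ⟩
    m + m + 3 + t                ≡⟨ cong₂ (λ s r → s + r + 3 + t) (sym eb) (sym ec) ⟩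
    (b + db) + (c + dc) + 3 + t  ≡⟨ rearrange₂ b db c dc t ⟩
    b + c + 3 + (db + dc + t)    ≤⟨ +-monoʳ-≤ (b + c + 3) le ⟩
    b + c + 3 + da               ∎)

module _ {S : List ℕ} (spread : SpreadOut S) where

  -- The condition at `p < r < s`, with `r + s` replaced by `p + q` and `q` bounded by the maximum,
  -- leaves `length S ≤ 3`.
  no-equal-sums-ordered : 3 < length S → ∀ {p q r s} → p ∈ S → q ∈ S → r ∈ S → s ∈ S →
    p < r → r < s → p + q ≢ r + s
  no-equal-sums-ordered 3<n {p} {q} {r} {s} p∈ q∈ r∈ s∈ p<r r<s sums =
    <⇒≱ 3<n (+-cancelˡ-≤ (maxList S + p) _ _ (begin
      maxList S + p + length S  ≤⟨ spread p∈ r∈ s∈ p<r r<s ⟩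
      r + s + 3                 ≡⟨ cong (_+ 3) (sym sums) ⟩
      p + q + 3                 ≤⟨ +-monoˡ-≤ 3 (+-monoʳ-≤ p (∈⇒≤maxList q∈)) ⟩
      p + maxList S + 3         ≡⟨ cong (_+ 3) (+-comm p (maxList S)) ⟩
      maxList S + p + 3         ∎))
    where open ≤-Reasoning

  no-equal-sums-sorted : 3 < length S → ∀ {p q r s} → p ∈ S → q ∈ S → r ∈ S → s ∈ S →
    p < q → r < s → p ≢ r → p + q ≢ r + s
  no-equal-sums-sorted 3<n {p} {q} {r} p∈ q∈ r∈ s∈ p<q r<s p≢r sums with <-cmp p r
  ... | tri< p<r _ _ = no-equal-sums-ordered 3<n p∈ q∈ r∈ s∈ p<r r<s sums
  ... | tri≈ _ p≡r _ = p≢r p≡r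
  ... | tri> _ _ r<p = no-equal-sums-ordered 3<n r∈ s∈ p∈ q∈ r<p p<q (sym sums)

  -- Four distinct entries force `3 < length S`. Each pair is sorted by commutativity, after which
  -- the pair with the smaller minimum plays the role of `p` and `q` in `no-equal-sums-ordered`.
  no-equal-sums : ∀ {p q r s} → p ∈ S → q ∈ S → r ∈ S → s ∈ S →
    Unique (p ∷ q ∷ r ∷ s ∷ []) → p + q ≢ r + s
  no-equal-sums {p} {q} {r} {s} p∈ q∈ r∈ s∈
    uniq@((p≢q ∷ p≢r ∷ p≢s ∷ []) ∷ (q≢r ∷ q≢s ∷ []) ∷ (r≢s ∷ []) ∷ [] ∷ []) sums
    with Unique⇒length≤ uniq (p∈ ∷ q∈ ∷ r∈ ∷ s∈ ∷ []) | <-cmp p q | <-cmp r s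
  ... | _   | tri≈ _ p≡q _ | _            = p≢q p≡q
  ... | _   | _            | tri≈ _ r≡s _ = r≢s r≡s
  ... | 3<n | tri< p<q _ _ | tri< r<s _ _ = no-equal-sums-sorted 3<n p∈ q∈ r∈ s∈ p<q r<s p≢r sums
  ... | 3<n | tri< p<q _ _ | tri> _ _ s<r = no-equal-sums-sorted 3<n p∈ q∈ s∈ r∈ p<q s<r p≢s (trans sums (+-comm r s))
  ... | 3<n | tri> _ _ q<p | tri< r<s _ _ = no-equal-sums-sorted 3<n q∈ p∈ r∈ s∈ q<p r<s q≢r (trans (+-comm q p) sums)
  ... | 3<n | tri> _ _ q<p | tri> _ _ s<r = no-equal-sums-sorted 3<n q∈ p∈ s∈ r∈ q<p s<r q≢s (trans (+-comm q p) (trans sums (+-comm r s)))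

-- Maximal chains of a poset whose sizes form `S`.

module Counting {_≼_ : Rel (Fin k) 0ℓ} (po : IsPartialOrder _≡_ _≼_) (_≼?_ : Decidable₂ _≼_)
  {S : List ℕ} (S≢[] : S ≢ []) (S-positive : All (1 ≤_) S) (S-unique : Unique S)
  (spread : SpreadOut S) (cards : MaxChainCardsEq _≼_ S) where

  open IsPartialOrder po renaming (refl to ≼-refl; trans to ≼-trans) using ()
  open Chains po _≼?_

  private
    L : List (Subset k)
    L = proj₁ cards

    L-unique : Unique L
    L-unique = proj₁ (proj₂ cards)

    sizes↭S : map ∣_∣ L ↭ S
    sizes↭S = proj₂ (proj₂ (proj₂ cards))

    ∈L⇒maximal : ∀ {D} → D ∈ L → IsMaximalChain _≼_ D
    ∈L⇒maximal {D} = Equivalence.to (proj₁ (proj₂ (proj₂ cards)) D)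

    maximal⇒∈L : ∀ {D} → IsMaximalChain _≼_ D → D ∈ L
    maximal⇒∈L {D} = Equivalence.from (proj₁ (proj₂ (proj₂ cards)) D)

    ∈L⇒chain : ∀ {D} → D ∈ L → IsChain _≼_ D
    ∈L⇒chain = proj₁ ∘ ∈L⇒maximal

    size∈S : ∀ {D} → D ∈ L → ∣ D ∣ ∈ S
    size∈S = ∈-resp-↭ sizes↭S ∘ ∈-map⁺ ∣_∣

    length-L : length L ≡ length S
    length-L = trans (sym (length-map ∣_∣ L)) (↭-length sizes↭S)

    size-injective : ∀ {D E} → D ∈ L → E ∈ L → ∣ D ∣ ≡ ∣ E ∣ → D ≡ E
    size-injective = Unique-map⇒injective
      (Unique-resp-↭ (setoid ℕ) (↭⇒↭ₛ (↭-sym sizes↭S)) S-unique)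

    larger⊉ : ∀ {D E} → D ∈ L → E ∈ L → ∣ D ∣ < ∣ E ∣ → ¬ D ⊆ E
    larger⊉ D∈L E∈L D<E D⊆E =
      <⇒≢ D<E (cong ∣_∣ (⊆⇒≡ (∈L⇒maximal D∈L) (∈L⇒maximal E∈L) D⊆E))

  -- Were `D`, `E` and their two splices all distinct, their sizes would be four distinct entries of
  -- `S` with equal pair sums. So two of the four coincide, and each coincidence turns the known
  -- agreement of a splice into agreement of `D` with `E`.
  non-crossing : ∀ {D E x} → D ∈ L → E ∈ L → x ∈ˢ D → x ∈ˢ E →
    Agree (_≼ x) D E ⊎ Agree (x ≼_) D E
  non-crossing {D} {E} {x} D∈L E∈L x∈D x∈E = decide
    where
    F G : Subset k
    F = splice x D E
    G = splice x E D

    F∈L : F ∈ L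
    F∈L = maximal⇒∈L (splice-maximal x∈D x∈E (∈L⇒maximal D∈L) (∈L⇒maximal E∈L))

    G∈L : G ∈ L
    G∈L = maximal⇒∈L (splice-maximal x∈E x∈D (∈L⇒maximal E∈L) (∈L⇒maximal D∈L))

    F-below : Agree (_≼ x) F D
    F-below = splice-below x∈D x∈E

    F-above : Agree (x ≼_) F E
    F-above = splice-above x∈D x∈E

    G-below : Agree (_≼ x) G E
    G-below = splice-below x∈E x∈D

    G-above : Agree (x ≼_) G D
    G-above = splice-above x∈E x∈D

    distinct : ∀ {A B} → A ∈ L → B ∈ L → A ≢ B → ∣ A ∣ ≢ ∣ B ∣
    distinct A∈L B∈L A≢B = A≢B ∘ size-injective A∈L B∈L

    decide : Agree (_≼ x) D E ⊎ Agree (x ≼_) D E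
    decide with F ≟ˢ G | F ≟ˢ D | F ≟ˢ E | G ≟ˢ D | G ≟ˢ E | D ≟ˢ E
    -- Below `x`, `F` follows `D` while `G` follows `E`.
    ... | yes F≡G | _ | _ | _ | _ | _ = inj₁ (Agree-trans (Agree-sym F-below)
            (subst (λ A → Agree (_≼ x) A E) (sym F≡G) G-below))
    ... | _ | yes F≡D | _ | _ | _ | _ = inj₂ (subst (λ A → Agree (x ≼_) A E) F≡D F-above)
    ... | _ | _ | yes F≡E | _ | _ | _ =
            inj₁ (Agree-sym (subst (λ A → Agree (_≼ x) A D) F≡E F-below))
    ... | _ | _ | _ | yes G≡D | _ | _ = inj₁ (subst (λ A → Agree (_≼ x) A E) G≡D G-below)
    ... | _ | _ | _ | _ | yes G≡E | _ =
            inj₂ (Agree-sym (subst (λ A → Agree (x ≼_) A D) G≡E G-above))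
    ... | _ | _ | _ | _ | _ | yes D≡E = inj₁ (subst (Agree (_≼ x) D) D≡E (λ _ → (λ y∈ → y∈) , (λ y∈ → y∈)))
    ... | no F≢G | no F≢D | no F≢E | no G≢D | no G≢E | no D≢E = contradiction
            (∣splice∣+∣splice∣ x∈D x∈E (∈L⇒chain D∈L) (∈L⇒chain E∈L))
            (no-equal-sums spread (size∈S F∈L) (size∈S G∈L) (size∈S D∈L) (size∈S E∈L)
              ((distinct F∈L G∈L F≢G ∷ distinct F∈L D∈L F≢D ∷ distinct F∈L E∈L F≢E ∷ []) ∷
               (distinct G∈L D∈L G≢D ∷ distinct G∈L E∈L G≢E ∷ []) ∷
               (distinct D∈L E∈L D≢E ∷ []) ∷ [] ∷ []))

  -- A maximal chain covered by two larger ones.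

  module _ {D J K u v} (D∈L : D ∈ L) (J∈L : J ∈ L) (K∈L : K ∈ L)
    (D<J : ∣ D ∣ < ∣ J ∣) (D<K : ∣ D ∣ < ∣ K ∣)
    (u∈D : u ∈ˢ D) (v∈D : v ∈ˢ D) (u≼v : u ≼ v) (u≢v : u ≢ v)
    (D-covered : ∀ {y} → y ∈ˢ D → y ≼ u ⊎ v ≼ y)
    (J-below : Agree (_≼ u) D J) (K-above : Agree (v ≼_) D K) where

    private
      u∈J : u ∈ˢ J
      u∈J = proj₁ (J-below ≼-refl) u∈D

      v∈K : v ∈ˢ K
      v∈K = proj₁ (K-above ≼-refl) v∈D

      -- If `u ≼ w`, the agreement carries the part of `D` below `u` from `J` into `K`. The part
      -- above `v` is in `K` already, so the maximal chain `D` would lie inside a larger one.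
      below-below : ∀ {w} → Agree (_≼ w) J K → ¬ u ≼ w
      below-below agree u≼w = larger⊉ D∈L K∈L D<K λ y∈D → [
        (λ y≼u → proj₁ (agree (≼-trans y≼u u≼w)) (proj₁ (J-below y≼u) y∈D)) ,
        (λ v≼y → proj₁ (K-above v≼y) y∈D) ]′ (D-covered y∈D)

      above-above : ∀ {w} → Agree (w ≼_) J K → ¬ w ≼ v
      above-above agree w≼v = larger⊉ D∈L J∈L D<J λ y∈D → [
        (λ y≼u → proj₁ (J-below y≼u) y∈D) ,
        (λ v≼y → proj₂ (agree (≼-trans w≼v v≼y)) (proj₁ (K-above v≼y) y∈D)) ]′ (D-covered y∈D)

      -- Apply `non-crossing` to `J` and `K` at a common point `w`. Agreement below `w` excludes
      -- `u ≼ w`, so comparability inside `J` gives `w ≼ u`, hence `w` is in `D`; both `w ≡ u` and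
      -- `w ≡ v` would restore `u ≼ w`. Agreement above is dual, with `v` and `K`.
      J∩K⊆D-u-v : J ∩ K ⊆ (D - u) - v
      J∩K⊆D-u-v {w} w∈J∩K with w∈J , w∈K ← x∈p∩q⁻ J K w∈J∩K
        with non-crossing J∈L K∈L w∈J w∈K
      ... | inj₁ agree with ∈L⇒chain J∈L u w u∈J w∈J
      ...   | inj₁ u≼w = contradiction u≼w (below-below agree)
      ...   | inj₂ w≼u = x∈p∧x≢y⇒x∈p-y (x∈p∧x≢y⇒x∈p-y (proj₂ (J-below w≼u) w∈J)
                (λ { refl → below-below agree ≼-refl }))
                (λ { refl → below-below agree u≼v })
      J∩K⊆D-u-v {w} w∈J∩K | inj₂ agree with ∈L⇒chain K∈L w v (proj₂ (x∈p∩q⁻ J K w∈J∩K)) v∈K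
      ...   | inj₁ w≼v = contradiction w≼v (above-above agree)
      ...   | inj₂ v≼w = x∈p∧x≢y⇒x∈p-y (x∈p∧x≢y⇒x∈p-y (proj₂ (K-above v≼w) (proj₂ (x∈p∩q⁻ J K w∈J∩K)))
                (λ { refl → above-above agree u≼v }))
                (λ { refl → above-above agree ≼-refl })

      ∣J∩K∣+2≤∣D∣ : 2 + ∣ J ∩ K ∣ ≤ ∣ D ∣
      ∣J∩K∣+2≤∣D∣ = begin
        2 + ∣ J ∩ K ∣         ≤⟨ s≤s (s≤s (p⊆q⇒∣p∣≤∣q∣ J∩K⊆D-u-v)) ⟩
        2 + ∣ (D - u) - v ∣   ≤⟨ s≤s (x∈p⇒∣p-x∣<∣p∣ (x∈p∧x≢y⇒x∈p-y v∈D (u≢v ∘ sym))) ⟩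
        1 + ∣ D - u ∣         ≤⟨ x∈p⇒∣p-x∣<∣p∣ u∈D ⟩
        ∣ D ∣                 ∎
        where open ≤-Reasoning

      m+∣D∣+n≤∣J∣+∣K∣+3 : maxList S + ∣ D ∣ + length S ≤ ∣ J ∣ + ∣ K ∣ + 3
      m+∣D∣+n≤∣J∣+∣K∣+3 with <-cmp ∣ J ∣ ∣ K ∣
      ... | tri< J<K _ _ = spread (size∈S D∈L) (size∈S J∈L) (size∈S K∈L) D<J J<K
      ... | tri> _ _ K<J = subst (λ s → maxList S + ∣ D ∣ + length S ≤ s + 3) (+-comm ∣ K ∣ ∣ J ∣)
              (spread (size∈S D∈L) (size∈S K∈L) (size∈S J∈L) D<K K<J)
      -- Equal sizes make `J` and `K` the same chain, which would then contain all of `D`.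
      ... | tri≈ _ J≡K _ with refl ← size-injective J∈L K∈L J≡K =
              ⊥-elim (larger⊉ D∈L J∈L D<J λ y∈D → [
                (λ y≼u → proj₁ (J-below y≼u) y∈D) ,
                (λ v≼y → proj₁ (K-above v≼y) y∈D) ]′ (D-covered y∈D))

    two-cover-bound : maxList S + length S ≤ 1 + k
    -- Adding `2 + ∣ D ∣` to both sides avoids subtraction; this is the amount that bounds
    -- `2 + (2 + ∣ J ∩ K ∣)` up to the same `2`.
    two-cover-bound = +-cancelʳ-≤ (2 + ∣ D ∣) _ _ (begin
      maxList S + length S + (2 + ∣ D ∣)    ≡⟨ rearrange₁ (maxList S) (length S) ∣ D ∣ ⟩
      maxList S + ∣ D ∣ + length S + 2      ≤⟨ +-monoˡ-≤ 2 m+∣D∣+n≤∣J∣+∣K∣+3 ⟩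
      ∣ J ∣ + ∣ K ∣ + 3 + 2                 ≡⟨ cong (λ s → s + 3 + 2) (sym (∣p∪q∣+∣p∩q∣≡∣p∣+∣q∣ J K)) ⟩
      ∣ J ∪ K ∣ + ∣ J ∩ K ∣ + 3 + 2         ≡⟨ rearrange₂ ∣ J ∪ K ∣ ∣ J ∩ K ∣ ⟩
      1 + ∣ J ∪ K ∣ + (2 + (2 + ∣ J ∩ K ∣)) ≤⟨ +-mono-≤ (s≤s (∣p∣≤n (J ∪ K))) (s≤s (s≤s ∣J∩K∣+2≤∣D∣)) ⟩
      1 + k + (2 + ∣ D ∣)                   ∎)
      where
      open ≤-Reasoning
      rearrange₁ : ∀ m n d → m + n + (2 + d) ≡ m + d + n + 2
      rearrange₁ = solve-∀
      rearrange₂ : ∀ a b → a + b + 3 + 2 ≡ 1 + a + (2 + (2 + b))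
      rearrange₂ = solve-∀

  -- Cutting a covered chain into a low and a high segment.

  LargerAgree : Subset k → Pred (Fin k) 0ℓ → Set
  LargerAgree D P = Any (λ E → ∣ D ∣ < ∣ E ∣ × Agree P D E) L

  module _ {D} (D∈L : D ∈ L)
    (covered : ∀ {x} → x ∈ˢ D → ∃ λ E → E ∈ L × ∣ D ∣ < ∣ E ∣ × x ∈ˢ E) where

    private
      -- `Low` is downward closed in `D`, because agreement below a point restricts to smaller
      -- points; `High` is the complementary upper segment.
      Low High : Pred (Fin k) 0ℓ
      Low  x = x ∈ˢ D × LargerAgree D (_≼ x)
      High x = x ∈ˢ D × ¬ LargerAgree D (_≼ x)

      LargerAgree-below? : Decidable (λ x → LargerAgree D (_≼ x))
      LargerAgree-below? x =
        Any.any? (λ E → (∣ D ∣ <? ∣ E ∣) ×-dec Agree? (_≼? x) D E) L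

      Low? : Decidable Low
      Low? x = (x ∈? D) ×-dec LargerAgree-below? x

      High? : Decidable High
      High? x = (x ∈? D) ×-dec ¬? (LargerAgree-below? x)

      low-or-high : ∀ {x} → x ∈ˢ D → Low x ⊎ High x
      low-or-high {x} x∈D with LargerAgree-below? x
      ... | yes low = inj₁ (x∈D , low)
      ... | no ¬low = inj₂ (x∈D , ¬low)

      -- A larger chain through `x` agrees with `D` on one side of `x`, and agreement below would
      -- make `x` low.
      High⇒LargerAgree-above : ∀ {x} → High x → LargerAgree D (x ≼_)
      High⇒LargerAgree-above (x∈D , ¬low) with E , E∈L , D<E , x∈E ← covered x∈D
        with non-crossing D∈L E∈L x∈D x∈E
      ... | inj₁ below = ⊥-elim (¬low (lose E∈L (D<E , below)))
      ... | inj₂ above = lose E∈L (D<E , above)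

      no-LargerAgree : ∀ {P : Pred (Fin k) 0ℓ} → (∀ {y} → y ∈ˢ D → P y) → ¬ LargerAgree D P
      no-LargerAgree all-P larger with E , E∈L , D<E , agree ← find larger =
        larger⊉ D∈L E∈L D<E (λ y∈D → proj₁ (agree (all-P y∈D)) y∈D)

      D-nonempty : Nonempty D
      D-nonempty = 0<∣p∣⇒Nonempty D (All.lookup S-positive (size∈S D∈L))

      greatest-low : ∃ Low → ∃ λ u → Low u × (∀ {y} → Low y → y ≼ u)
      greatest-low = least (Flip.isPartialOrder po) (flip _≼?_) Low?
        (λ (x∈D , _) (y∈D , _) → ∈L⇒chain D∈L _ _ y∈D x∈D)

      least-high : ∃ High → ∃ λ v → High v × (∀ {y} → High y → v ≼ y)
      least-high = least po _≼?_ High?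
        (λ (x∈D , _) (y∈D , _) → ∈L⇒chain D∈L _ _ x∈D y∈D)

      some-high : ∃ High
      some-high with any? High?
      ... | yes high = high
      -- If all of `D` were low, so would be its greatest element, and the larger chain witnessing
      -- this would contain `D`.
      ... | no ∄high = contradiction (proj₂ low-u) (no-LargerAgree (u-max ∘ low))
        where
        low : ∀ {y} → y ∈ˢ D → Low y
        low {y} y∈D = [ (λ l → l) , (λ h → contradiction (y , h) ∄high) ]′ (low-or-high y∈D)
        low-u = proj₁ (proj₂ (greatest-low (_ , low (proj₂ D-nonempty))))
        u-max = proj₂ (proj₂ (greatest-low (_ , low (proj₂ D-nonempty))))

      some-low : ∃ Low
      some-low with any? Low?
      ... | yes low = low
      -- Dually, the least element of `D` would be high, with a larger chain agreeing with `D`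
      -- everywhere above it.
      ... | no ∄low = contradiction (High⇒LargerAgree-above high-v) (no-LargerAgree (v-min ∘ high))
        where
        high : ∀ {y} → y ∈ˢ D → High y
        high {y} y∈D = [ (λ l → contradiction (y , l) ∄low) , (λ h → h) ]′ (low-or-high y∈D)
        high-v = proj₁ (proj₂ (least-high (_ , high (proj₂ D-nonempty))))
        v-min = proj₂ (proj₂ (least-high (_ , high (proj₂ D-nonempty))))

    -- The cut lies between the greatest low point `u` and the least high point `v`: every element
    -- of `D` is at most `u` or at least `v`. The chains witnessing the two agreements serve as `J`
    -- and `K`.
    covered-bound : maxList S + length S ≤ 1 + k
    covered-bound
      with u , (u∈D , low-u) , u-max ← greatest-low some-low
         | v , high-v@(v∈D , ¬low-v) , v-min ← least-high some-high
      with J , J∈L , D<J , J-below ← find low-u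
         | K , K∈L , D<K , K-above ← find (High⇒LargerAgree-above high-v)
      = two-cover-bound D∈L J∈L K∈L D<J D<K u∈D v∈D
          ([ (λ u≼v → u≼v) , (λ v≼u → contradiction (low-below v≼u) ¬low-v) ]′ (∈L⇒chain D∈L u v u∈D v∈D))
          (λ { refl → ¬low-v low-u })
          (Sum.map u-max v-min ∘ low-or-high)
          J-below K-above
      where
      low-below : v ≼ u → LargerAgree D (_≼ v)
      low-below v≼u = lose J∈L (D<J , λ y≼v → J-below (≼-trans y≼v v≼u))

  -- Elements lying in no larger maximal chain, and the final count.

  New : Subset k → Fin k → Set
  New D x = x ∈ˢ D × All (λ E → ∣ D ∣ < ∣ E ∣ → x ∉ˢ E) L

  New? : Decidable₂ New
  New? D x = (x ∈? D) ×-dec All.all? (λ E → (∣ D ∣ <? ∣ E ∣) →-dec ¬? (x ∈? E)) L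

  -- Sizes are distinct, so at most one maximal chain through `x` is the largest.
  New-injective : ∀ {D E x} → D ∈ L × New D x → E ∈ L × New E x → D ≡ E
  New-injective {D} {E} (D∈L , x∈D , D-new) (E∈L , x∈E , E-new) with <-cmp ∣ D ∣ ∣ E ∣
  ... | tri< D<E _ _ = contradiction x∈E (All.lookup D-new E∈L D<E)
  ... | tri≈ _ D≡E _ = size-injective D∈L E∈L D≡E
  ... | tri> _ _ E<D = contradiction x∈D (All.lookup E-new D∈L E<D)

  all-new-bound : All (λ D → ∃ (New D)) L → maxList S + length S ≤ 1 + k
  all-new-bound all-new
    with C , C∈L , m≡∣C∣ ← ∈-map⁻ ∣_∣ (∈-resp-↭ (↭-sym sizes↭S) (maxList∈ S≢[] S-positive))
    with L′ , L↭ ← ∈⇒↭∷ C∈L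
    with C∉L′ ∷ L′-unique ← Unique-resp-↭ (setoid _) (↭⇒↭ₛ L↭) L-unique
    = begin
      maxList S + length S    ≡⟨ cong₂ _+_ m≡∣C∣ (trans (sym length-L) (↭-length L↭)) ⟩
      ∣ C ∣ + suc (length L′) ≡⟨ +-comm ∣ C ∣ _ ⟩
      suc (length L′ + ∣ C ∣) ≤⟨ s≤s (≤-trans (proj₁ (proj₂ choice)) (∣p∣≤n (proj₁ choice))) ⟩
      suc k                   ∎
    where
    open ≤-Reasoning

    L′⊆L : ∀ {D} → D ∈ L′ → D ∈ L
    L′⊆L = ∈-resp-↭ (↭-sym L↭) ∘ there

    D<C : ∀ {D} → D ∈ L′ → ∣ D ∣ < ∣ C ∣
    D<C {D} D∈L′ = ≤∧≢⇒< (subst (∣ D ∣ ≤_) m≡∣C∣ (∈⇒≤maxList (size∈S (L′⊆L D∈L′))))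
      (All.lookup C∉L′ D∈L′ ∘ sym ∘ size-injective (L′⊆L D∈L′) C∈L)

    -- `C` has maximum size, so it is one of the larger chains that a new element of `D` must avoid.
    new-outside-C : ∀ {D} → D ∈ L′ → ∃ λ x → (D ∈ L × New D x) × x ∉ˢ C
    new-outside-C D∈L′ with x , new ← All.lookup all-new (L′⊆L D∈L′) =
      x , (L′⊆L D∈L′ , new) , All.lookup (proj₂ new) C∈L (D<C D∈L′)

    choice = transversal {R = λ D x → D ∈ L × New D x} New-injective C L′-unique
      (All.tabulate new-outside-C)

  bound : maxList S + length S ≤ 1 + k
  bound with All.all? (λ D → any? (New? D)) L
  ... | yes all-new = all-new-bound all-new
  ... | no ¬all-new with D , D∈L , ¬new ← find (¬All⇒Any¬ (λ D → any? (New? D)) L ¬all-new) =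
    covered-bound D∈L covered
    where
    larger-containing? : ∀ x → Decidable (λ E → ∣ D ∣ < ∣ E ∣ × x ∈ˢ E)
    larger-containing? x E = (∣ D ∣ <? ∣ E ∣) ×-dec (x ∈? E)

    covered : ∀ {x} → x ∈ˢ D → ∃ λ E → E ∈ L × ∣ D ∣ < ∣ E ∣ × x ∈ˢ E
    covered {x} x∈D with Any.any? (larger-containing? x) L
    ... | yes larger = find larger
    ... | no ∄larger = contradiction
      -- A point of `D` in no larger chain would be new for `D`, which has no new element.
      (x , x∈D , All.tabulate (λ E∈L D<E x∈E → ∄larger (lose E∈L (D<E , x∈E)))) ¬new

-- From decidable to arbitrary orders.

-- Double negation commutes with products over `Fin k`, so the doubly negated excluded middle for
-- each pair combines into one statement about the whole relation.
¬¬-decidable : (_≼_ : Rel (Fin k) 0ℓ) → ¬ ¬ Decidable₂ _≼_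
¬¬-decidable _≼_ = sequence applicative (λ x → sequence applicative (λ y → ¬¬-excluded-middle))
  where applicative = RawMonad.rawApplicative ¬¬-Monad

theorem3 : (S : List ℕ) → S ≢ [] → All (λ x → 1 ≤ x) S → Unique S →
    (∀ a b c → a ∈ S → b ∈ S → c ∈ S → a < b → b < c →
    (maxList S ∸ b) + (maxList S ∸ c) + (length S ∸ 3) ≤ maxList S ∸ a) →
    (k : ℕ) (_≼_ : Rel (Fin k) 0ℓ) → IsPartialOrder _≡_ _≼_ →
    MaxChainCardsEq _≼_ S →
    maxList S + length S ∸ 1 ≤ k
theorem3 S S≢[] S-positive S-unique condition k _≼_ po cards =
  -- The order need not be decidable, but the goal is ¬¬-stable.
  decidable-stable (_ ≤? k) λ ¬goal → ¬¬-decidable _≼_ λ _≼?_ → ¬goal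
    (m≤n+o⇒m∸n≤o _ 1 (Counting.bound po _≼?_ S≢[] S-positive S-unique
      (∸-condition⇒SpreadOut condition) cards))
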